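{- For $n\ge 1$ let $\tau$ be a plane increasing binary tree of size $n$ chosen uniformly at random, and let $X_n$ be the number of distinct shapes (unlabeled plane binary trees) among the fringe subtrees of $\tau$, i.e. the size of the compacted tree of $\tau$. Then \[ \mathbb{E}(X_n) = \mathcal{O}\!\left(\frac{n}{\log n}\right) \quad \text{as } n\to\infty . \]
   Context: A plane binary tree is a rooted tree in which every node has a left and a right slot, each of which is either empty or holds a subtree (left and right are distinguished); its size is its number of nodes. A plane increasing binary tree of size $n$ is a plane binary tree with $n$ nodes labeled by the distinct integers $1,\dots,n$ such that labels increase along every path from the root; there are $n!$ of them (this is the random binary search tree model). The shape of such a tree is the unlabeled plane binary tree obtained by forgetting the labels. A fringe subtree is a node together with all its descendants. The compacted tree keeps one copy of each distinct fringe-subtree shape. -}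

module Defs where

open import Data.Integer.Base using (+_)
open import Data.List.Base using (List; []; _∷_; _++_; length; map; filter;
  deduplicate; applyUpTo; cartesianProductWith; cartesianProduct)
open import Data.List.Membership.Propositional using (_∈_)
open import Data.List.Membership.Propositional.Properties
  using (∈-filter⁺; ∈-filter⁻; ∈-cartesianProductWith⁺; ∈-cartesianProductWith⁻;
         ∈-cartesianProduct⁺; ∈-applyUpTo⁺)
open import Data.List.Properties using (length-++)
open import Data.List.Relation.Unary.All as All using (All; []; _∷_; all?)
open import Data.List.Relation.Unary.All.Properties using (++⁻ˡ; ++⁻ʳ)
open import Data.List.Relation.Unary.AllPairs as AllPairs using ([]; _∷_)
open import Data.List.Relation.Unary.Any using (here; there)
open import Data.List.Relation.Unary.Unique.Propositional using (Unique)
open import Data.List.Relation.Unary.Unique.Propositional.Properties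
  using (filter⁺; applyUpTo⁺₁; cartesianProductWith⁺; cartesianProduct⁺)
open import Data.Nat.Base as ℕ using (ℕ; zero; suc; _≤_; _<_; s≤s; NonZero)
open import Data.Nat.ListAction using (sum)
open import Data.Nat.Logarithm using (⌊log₂_⌋)
open import Data.Nat.Properties as ℕ using (_≟_; _<?_; _≤?_)
open import Data.Product using (_×_; _,_; proj₁; proj₂; ∃-syntax; uncurry)
open import Data.Rational.Base as ℚ using (ℚ; 0ℚ; _/_)
open import Function.Base using (_∘_)
open import Function.Bundles using (_⇔_; mk⇔; module Equivalence)
open import Relation.Binary.Definitions using (DecidableEquality)
open import Relation.Binary.PropositionalEquality
  using (_≡_; _≢_; refl; cong; cong₂; subst)
open import Relation.Nullary.Decidable using (yes; no; map′; _×-dec_; ¬?)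
open import Relation.Unary using (Decidable)

-- Plane binary trees; `empty` is an empty slot, not a node.
data Shape : Set where
  empty : Shape
  node  : (l r : Shape) → Shape

data Tree : Set where
  empty : Tree
  node  : (l : Tree) (label : ℕ) (r : Tree) → Tree

shape : Tree → Shape
shape empty        = empty
shape (node l _ r) = node (shape l) (shape r)

labels : Tree → List ℕ
labels empty        = []
labels (node l k r) = k ∷ labels l ++ labels r

-- One entry per node: `empty` is not counted as a fringe subtree.
fringeSubtrees : Tree → List Tree
fringeSubtrees empty          = []
fringeSubtrees t@(node l _ r) = t ∷ fringeSubtrees l ++ fringeSubtrees r

_≟ˢ_ : DecidableEquality Shape
empty    ≟ˢ empty      = yes refl
empty    ≟ˢ node _ _   = no λ ()
node _ _ ≟ˢ empty      = no λ ()
node l r ≟ˢ node l′ r′ =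
  map′ (uncurry (cong₂ node)) (λ { refl → refl , refl }) (l ≟ˢ l′ ×-dec r ≟ˢ r′)

compactedSize : Tree → ℕ
compactedSize t = length (deduplicate _≟ˢ_ (map shape (fringeSubtrees t)))

data Increasing : Tree → Set where
  empty : Increasing empty
  node  : ∀ {l k r} → All (k <_) (labels l) → All (k <_) (labels r) →
          Increasing l → Increasing r → Increasing (node l k r)

record IsIncreasingTree (n : ℕ) (t : Tree) : Set where
  constructor mkIsIncreasingTree
  field
    size≡n     : length (labels t) ≡ n
    distinct   : Unique (labels t)
    inRange    : All (λ k → 1 ≤ k × k ≤ n) (labels t)
    increasing : Increasing t

increasing? : Decidable Increasing
increasing? empty        = yes empty
increasing? (node l k r) =
  map′ (λ (a , b , c , d) → node a b c d) (λ { (node a b c d) → a , b , c , d })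
    (all? (k <?_) (labels l) ×-dec all? (k <?_) (labels r) ×-dec
     increasing? l ×-dec increasing? r)

isIncreasingTree? : ∀ n → Decidable (IsIncreasingTree n)
isIncreasingTree? n t =
  map′ (λ (a , b , c , d) → mkIsIncreasingTree a b c d)
       (λ (mkIsIncreasingTree a b c d) → a , b , c , d)
    (length (labels t) ≟ n ×-dec
     AllPairs.allPairs? (λ x y → ¬? (x ≟ y)) (labels t) ×-dec
     all? (λ k → 1 ≤? k ×-dec k ≤? n) (labels t) ×-dec
     increasing? t)

[1⋯_] : ℕ → List ℕ
[1⋯ n ] = applyUpTo suc n

join : Tree → ℕ × Tree → Tree
join l (k , r) = node l k r

-- All trees of height at most h with labels drawn from ks.
treesOfHeight≤ : ℕ → List ℕ → List Tree
treesOfHeight≤ zero    ks = empty ∷ []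
treesOfHeight≤ (suc h) ks =
  empty ∷ cartesianProductWith join (treesOfHeight≤ h ks)
                                    (cartesianProduct ks (treesOfHeight≤ h ks))

-- A tree of size n has height at most n, so this list contains every
-- increasing tree of size n, exactly once (see the two lemmas that follow).
increasingTrees : ℕ → List Tree
increasingTrees n = filter (isIncreasingTree? n) (treesOfHeight≤ n [1⋯ n ])

private
  ∈-[1⋯] : ∀ {n k} → 1 ≤ k × k ≤ n → k ∈ [1⋯ n ]
  ∈-[1⋯] {k = suc k} (_ , k<n) = ∈-applyUpTo⁺ suc k<n

  ∈-treesOfHeight≤ : ∀ h {ks} t → length (labels t) ≤ h →
                     All (_∈ ks) (labels t) → t ∈ treesOfHeight≤ h ks
  ∈-treesOfHeight≤ zero    empty        _       _        = here refl
  ∈-treesOfHeight≤ (suc h) empty        _       _        = here refl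
  ∈-treesOfHeight≤ (suc h) (node l k r) (s≤s p) (k∈ ∷ q) =
    there (∈-cartesianProductWith⁺ join
      (∈-treesOfHeight≤ h l (ℕ.m+n≤o⇒m≤o (length (labels l)) p′) (++⁻ˡ (labels l) q))
      (∈-cartesianProduct⁺ k∈
        (∈-treesOfHeight≤ h r (ℕ.m+n≤o⇒n≤o (length (labels l)) p′) (++⁻ʳ (labels l) q))))
    where p′ = subst (_≤ h) (length-++ (labels l)) p

  treesOfHeight≤-unique : ∀ h {ks} → Unique ks → Unique (treesOfHeight≤ h ks)
  treesOfHeight≤-unique zero    _ = [] ∷ []
  treesOfHeight≤-unique (suc h) {ks} u =
    All.tabulate empty∉ ∷
    cartesianProductWith⁺ join (λ { refl → refl , refl }) ih (cartesianProduct⁺ u ih)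
    where
    ih = treesOfHeight≤-unique h u
    ts = treesOfHeight≤ h ks
    empty∉ : ∀ {t} → t ∈ cartesianProductWith join ts (cartesianProduct ks ts) →
             empty ≢ t
    empty∉ t∈ refl
      with _ , _ , _ , _ , () ← ∈-cartesianProductWith⁻ join ts (cartesianProduct ks ts) t∈

∈-increasingTrees : ∀ {n t} → t ∈ increasingTrees n ⇔ IsIncreasingTree n t
∈-increasingTrees {n} {t} = mk⇔
  (λ t∈ → proj₂ (∈-filter⁻ (isIncreasingTree? n) {xs = treesOfHeight≤ n [1⋯ n ]} t∈))
  (λ p → let open IsIncreasingTree p in
    ∈-filter⁺ (isIncreasingTree? n)
      (∈-treesOfHeight≤ n t (ℕ.≤-reflexive size≡n) (All.map ∈-[1⋯] inRange)) p)

increasingTrees-unique : ∀ n → Unique (increasingTrees n)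
increasingTrees-unique n = filter⁺ (isIncreasingTree? n)
  (treesOfHeight≤-unique n
    (applyUpTo⁺₁ suc n (λ i<j _ eq → ℕ.<⇒≢ i<j (ℕ.suc-injective eq))))

private
  path : ℕ → ℕ → Tree
  path k zero    = empty
  path k (suc m) = node empty k (path (suc k) m)

  path-length : ∀ k m → length (labels (path k m)) ≡ m
  path-length k zero    = refl
  path-length k (suc m) = cong suc (path-length (suc k) m)

  path-range : ∀ k m → All (λ i → k ≤ i × i < k ℕ.+ m) (labels (path k m))
  path-range k zero    = []
  path-range k (suc m) rewrite ℕ.+-suc k m =
    (ℕ.≤-refl , s≤s (ℕ.m≤m+n k m)) ∷
    All.map (λ (a , b) → ℕ.<⇒≤ a , b) (path-range (suc k) m)

  path-distinct : ∀ k m → Unique (labels (path k m))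
  path-distinct k zero    = []
  path-distinct k (suc m) =
    All.map (ℕ.<⇒≢ ∘ proj₁) (path-range (suc k) m) ∷ path-distinct (suc k) m

  path-increasing : ∀ k m → Increasing (path k m)
  path-increasing k zero    = empty
  path-increasing k (suc m) =
    node [] (All.map proj₁ (path-range (suc k) m)) empty (path-increasing (suc k) m)

  nonZero-length : ∀ {A : Set} {x : A} {xs} → x ∈ xs → NonZero (length xs)
  nonZero-length {xs = _ ∷ _} _ = _

increasingTrees-nonEmpty : ∀ n → NonZero (length (increasingTrees n))
increasingTrees-nonEmpty n = nonZero-length
  (Equivalence.from (∈-increasingTrees {n} {path 1 n})
    (mkIsIncreasingTree (path-length 1 n) (path-distinct 1 n)
      (All.map (λ { (a , s≤s b) → a , b }) (path-range 1 n))
      (path-increasing 1 n)))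

-- Expectation of f over a uniformly random increasing tree of size n.
𝔼 : ℕ → (Tree → ℕ) → ℚ
𝔼 n f = (+ sum (map f (increasingTrees n)) / length (increasingTrees n))
  {{increasingTrees-nonEmpty n}}

-- The library's logarithm is ⌊log₂ n⌋.  For n ≥ 2 it lies between ½ log₂ n and
-- log₂ n, so replacing log n by it does not change the class O(n / log n).
-- The values at n = 0, 1, where ⌊log₂ n⌋ = 0, are placeholders.
n/log : ℕ → ℚ
n/log 0                 = 0ℚ
n/log 1                 = 0ℚ
n/log n@(suc (suc _))   = + n / ⌊log₂ n ⌋

infix 4 _∈O_
_∈O_ : (f g : ℕ → ℚ) → Set
f ∈O g = ∃[ C ] ∃[ N ] ∀ n → N ≤ n → ℚ.∣ f n ∣ ℚ.≤ C ℚ.* ℚ.∣ g n ∣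

{-# OPTIONS --safe #-}

-- Inserting the label n + 1 into one of the n + 1 empty slots produces every increasing tree of
-- size n + 1 exactly once from those of size n.  Let T k n be the number of fringe subtrees
-- (empty slots included) of size at least k, summed over the N = n! increasing trees of size n.
-- An insertion enlarges precisely the fringe subtrees around the chosen slot, whence
--   T (k + 1) (n + 1) + (k + 1) T (k + 1) n = (n + 1) T (k + 1) n + (k + 1) T k n,
-- and by induction (k + 1) T k n ≤ 2 (n + 1) N.  A compacted tree has at most 4ᵏ nodes of size
-- less than k, as a binary code of length 2k determines such a shape, and at most one node per
-- fringe subtree of size at least k.  Taking k of order log n gives n / log n.
module Submission where

open import Defs
import Data.Integer.Base as ℤ
import Data.Integer.Properties as ℤ
open import Data.List.Base using (List; []; _∷_; _++_; [_]; map; concatMap; length;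
  filter; deduplicate)
open import Data.List.Membership.DecPropositional using (_∈?_)
open import Data.List.Membership.Propositional using (_∈_; _∉_; find; lose)
open import Data.List.Membership.Propositional.Properties
  using (∈-map⁺; ∈-map⁻; ∈-++⁺ˡ; ∈-++⁺ʳ; ∈-++⁻; ∈-∃++; ∈-filter⁺; ∈-applyUpTo⁺;
         ∈-concatMap⁺; ∈-concatMap⁻; ∈-deduplicate⁻)
open import Data.List.Membership.Propositional.Properties.WithK using (unique∧set⇒bag)
open import Data.List.Properties using (length-++; length-map; length-applyUpTo; map-++;
  filter-++; filter-accept; filter-reject)
open import Data.List.Relation.Binary.BagAndSetEquality using (∼bag⇒↭)
open import Data.List.Relation.Binary.Disjoint.Propositional using (Disjoint)
open import Data.List.Relation.Binary.Permutation.Propositional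
  using (_↭_; ↭-refl; ↭-sym; ↭-trans; ↭-prep; ↭-swap; ↭⇒↭ₛ)
open import Data.List.Relation.Binary.Permutation.Propositional.Properties
  using (All-resp-↭; ∈-resp-↭; ↭-length; shift; ++⁺ˡ; ++⁺ʳ; map⁺)
import Data.List.Relation.Binary.Permutation.Setoid.Properties as Permutationₛ
open import Data.List.Relation.Binary.Subset.Propositional using (_⊆_)
open import Data.List.Relation.Unary.All as All using (All; []; _∷_)
open import Data.List.Relation.Unary.All.Properties using (++⁻ˡ; ++⁻ʳ)
open import Data.List.Relation.Unary.AllPairs using ([]; _∷_)
open import Data.List.Relation.Unary.Any using (here; there)
open import Data.List.Relation.Unary.Unique.DecPropositional.Properties _≟ˢ_
  using (deduplicate-!)
open import Data.List.Relation.Unary.Unique.Propositional using (Unique)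
import Data.List.Relation.Unary.Unique.Propositional.Properties as Unique
open import Data.Nat.Base using (ℕ; zero; suc; _+_; _*_; _∸_; _^_; _/_; _≤_; _<_; z≤n; s≤s;
  NonZero; ⌊_/2⌋)
open import Data.Nat.DivMod using (m/n*n≤m; m%n<n; m≡m%n+[m/n]*n; _%_)
open import Data.Nat.Induction using (<-rec)
open import Data.Nat.ListAction using (sum)
open import Data.Nat.ListAction.Properties using (sum-++; sum-↭)
open import Data.Nat.Logarithm using (⌊log₂_⌋; ⌊log₂⌊n/2⌋⌋≡⌊log₂n⌋∸1)
open import Data.Nat.Properties
open import Data.Nat.Tactic.RingSolver using (solve-∀)
open import Data.Product using (∃-syntax; _×_; _,_; proj₁; proj₂)
import Data.Rational.Base as ℚ
import Data.Rational.Properties as ℚ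
import Data.Rational.Unnormalised.Base as ℚᵘ
import Data.Rational.Unnormalised.Properties as ℚᵘ
open import Data.Sum.Base using (inj₁; inj₂)
open import Function.Base using (_∘_; case_of_)
open import Function.Bundles using (mk⇔; module Equivalence)
open import Relation.Binary.PropositionalEquality
  using (_≡_; refl; sym; trans; cong; cong₂; subst; setoid; module ≡-Reasoning)
open import Relation.Binary.Definitions using (tri<; tri≈; tri>)
open import Relation.Nullary.Decidable using (yes; no)
open import Relation.Nullary.Negation using (¬_; contradiction)

-- Counting and finite sums over lists.

private
  variable
    A B : Set

unique⊆⇒length≤ : {xs ys : List A} → Unique xs → xs ⊆ ys → length xs ≤ length ys
unique⊆⇒length≤ {xs = []}     _        _     = z≤n
unique⊆⇒length≤ {xs = x ∷ xs} (x∉ ∷ u) xs⊆ys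
  with as , bs , refl ← ∈-∃++ (xs⊆ys (here refl)) = begin
    suc (length xs)         ≤⟨ s≤s (unique⊆⇒length≤ u xs⊆as++bs) ⟩
    length (x ∷ as ++ bs)   ≡⟨ ↭-length (shift x as bs) ⟨
    length (as ++ x ∷ bs)   ∎
  where
  open ≤-Reasoning
  xs⊆as++bs : xs ⊆ as ++ bs
  xs⊆as++bs y∈ with ∈-resp-↭ (shift x as bs) (xs⊆ys (there y∈))
  ... | here refl = contradiction refl (All.lookup x∉ y∈)
  ... | there y∈′ = y∈′

Σ : List A → (A → ℕ) → ℕ
Σ xs f = sum (map f xs)

Σ-++ : ∀ (f : A → ℕ) xs ys → Σ (xs ++ ys) f ≡ Σ xs f + Σ ys f
Σ-++ f xs ys = trans (cong sum (map-++ f xs ys)) (sum-++ (map f xs) (map f ys))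

Σ-map : ∀ (f : B → ℕ) (g : A → B) xs → Σ (map g xs) f ≡ Σ xs (f ∘ g)
Σ-map f g []       = refl
Σ-map f g (x ∷ xs) = cong (f (g x) +_) (Σ-map f g xs)

Σ-concatMap : ∀ (f : B → ℕ) (g : A → List B) xs →
              Σ (concatMap g xs) f ≡ Σ xs (λ x → Σ (g x) f)
Σ-concatMap f g []       = refl
Σ-concatMap f g (x ∷ xs) =
  trans (Σ-++ f (g x) (concatMap g xs)) (cong (Σ (g x) f +_) (Σ-concatMap f g xs))

Σ-cong : ∀ {f g : A → ℕ} xs → (∀ {x} → x ∈ xs → f x ≡ g x) → Σ xs f ≡ Σ xs g
Σ-cong []       f≡g = refl
Σ-cong (x ∷ xs) f≡g = cong₂ _+_ (f≡g (here refl)) (Σ-cong xs (f≡g ∘ there))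

Σ-mono : ∀ {f g : A → ℕ} xs → (∀ {x} → x ∈ xs → f x ≤ g x) → Σ xs f ≤ Σ xs g
Σ-mono []       f≤g = z≤n
Σ-mono (x ∷ xs) f≤g = +-mono-≤ (f≤g (here refl)) (Σ-mono xs (f≤g ∘ there))

Σ-+ : ∀ (f g : A → ℕ) xs → Σ xs (λ x → f x + g x) ≡ Σ xs f + Σ xs g
Σ-+ f g []       = refl
Σ-+ f g (x ∷ xs) = trans (cong (f x + g x +_) (Σ-+ f g xs)) (interchange (f x) (g x) (Σ xs f) (Σ xs g))
  where
  interchange : ∀ a b c d → a + b + (c + d) ≡ (a + c) + (b + d)
  interchange = solve-∀

Σ-* : ∀ c (f : A → ℕ) xs → Σ xs (λ x → c * f x) ≡ c * Σ xs f
Σ-* c f []       = sym (*-zeroʳ c)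
Σ-* c f (x ∷ xs) =
  trans (cong (c * f x +_) (Σ-* c f xs)) (sym (*-distribˡ-+ c (f x) (Σ xs f)))

Σ-const : ∀ c (xs : List A) → Σ xs (λ _ → c) ≡ length xs * c
Σ-const c []       = refl
Σ-const c (x ∷ xs) = cong (c +_) (Σ-const c xs)

Σ-1 : ∀ (xs : List A) → Σ xs (λ _ → 1) ≡ length xs
Σ-1 xs = trans (Σ-const 1 xs) (*-identityʳ (length xs))

-- Inserting a new largest label into an empty slot.

insertions : ℕ → Tree → List Tree
insertions m empty        = [ node empty m empty ]
insertions m (node l k r) =
  map (λ l′ → node l′ k r) (insertions m l) ++ map (node l k) (insertions m r)

-- A derivation is the path from the root to the chosen slot, so properties of a single insertion
-- are proved by recursion on that path instead of on membership in `insertions`.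
data Insert (m : ℕ) : Tree → Tree → Set where
  slot  : Insert m empty (node empty m empty)
  left  : ∀ {l l′ k r} → Insert m l l′ → Insert m (node l k r) (node l′ k r)
  right : ∀ {l k r r′} → Insert m r r′ → Insert m (node l k r) (node l k r′)

∈-insertions⁺ : ∀ {m t t′} → Insert m t t′ → t′ ∈ insertions m t
∈-insertions⁺ slot      = here refl
∈-insertions⁺ (left p)  = ∈-++⁺ˡ (∈-map⁺ _ (∈-insertions⁺ p))
∈-insertions⁺ (right p) = ∈-++⁺ʳ _ (∈-map⁺ _ (∈-insertions⁺ p))

∈-insertions⁻ : ∀ {m} t {t′} → t′ ∈ insertions m t → Insert m t t′
∈-insertions⁻ empty (here refl) = slot
∈-insertions⁻ {m} (node l k r) t′∈ with ∈-++⁻ (map _ (insertions m l)) t′∈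
... | inj₁ t′∈ˡ with _ , l′∈ , refl ← ∈-map⁻ _ t′∈ˡ = left (∈-insertions⁻ l l′∈)
... | inj₂ t′∈ʳ with _ , r′∈ , refl ← ∈-map⁻ _ t′∈ʳ = right (∈-insertions⁻ r r′∈)

-- The new label lands somewhere inside the preorder list. A permutation is enough, since size,
-- distinctness and range do not depend on the order of the labels.
insert-labels : ∀ {m t t′} → Insert m t t′ → labels t′ ↭ m ∷ labels t
insert-labels slot = ↭-refl
insert-labels {m} (left {k = k} {r} p) =
  ↭-trans (↭-prep k (++⁺ʳ (labels r) (insert-labels p))) (↭-swap k m ↭-refl)
insert-labels {m} (right {l} {k} {r} p) =
  ↭-trans (↭-prep k (↭-trans (++⁺ˡ (labels l) (insert-labels p)) (shift m (labels l) (labels r))))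
          (↭-swap k m ↭-refl)

-- Only the ancestors of the slot acquire a new descendant, and `m` exceeds all their labels.
insert-increasing⁺ : ∀ {m t t′} → Insert m t t′ → All (_< m) (labels t) →
                     Increasing t → Increasing t′
insert-increasing⁺ slot _ _ = node [] [] empty empty
insert-increasing⁺ (left {l} p) (k<m ∷ <m) (node k<l k<r il ir) =
  node (All-resp-↭ (↭-sym (insert-labels p)) (k<m ∷ k<l)) k<r
       (insert-increasing⁺ p (++⁻ˡ (labels l) <m) il) ir
insert-increasing⁺ (right {l} p) (k<m ∷ <m) (node k<l k<r il ir) =
  node k<l (All-resp-↭ (↭-sym (insert-labels p)) (k<m ∷ k<r))
       il (insert-increasing⁺ p (++⁻ʳ (labels l) <m) ir)

insert-increasing⁻ : ∀ {m t t′} → Insert m t t′ → Increasing t′ → Increasing t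
insert-increasing⁻ slot _ = empty
insert-increasing⁻ (left p) (node k<l k<r il ir) =
  node (All.tail (All-resp-↭ (insert-labels p) k<l)) k<r (insert-increasing⁻ p il) ir
insert-increasing⁻ (right p) (node k<l k<r il ir) =
  node k<l (All.tail (All-resp-↭ (insert-labels p) k<r)) il (insert-increasing⁻ p ir)

inserted∈labels : ∀ {m t t′} → Insert m t t′ → m ∈ labels t′
inserted∈labels p = ∈-resp-↭ (↭-sym (insert-labels p)) (here refl)

-- The position of `m` in `t′` determines the slot. If the two paths diverged, the subtree that one
-- insertion leaves alone would already contain `m`, against `m∉t` or `m∉u`.
insert-injective : ∀ {m t u t′} → m ∉ labels t → m ∉ labels u →
                   Insert m t t′ → Insert m u t′ → t ≡ u
insert-injective _ _ slot slot = refl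
insert-injective {t = node _ k r} m∉t m∉u (left p) (left q) =
  cong (λ l → node l k r)
    (insert-injective (m∉t ∘ there ∘ ∈-++⁺ˡ) (m∉u ∘ there ∘ ∈-++⁺ˡ) p q)
insert-injective {t = node l k _} m∉t m∉u (right p) (right q) =
  cong (node l k)
    (insert-injective (m∉t ∘ there ∘ ∈-++⁺ʳ (labels l)) (m∉u ∘ there ∘ ∈-++⁺ʳ (labels l)) p q)
insert-injective m∉t m∉u (left p) (right q) =
  contradiction (there (∈-++⁺ˡ (inserted∈labels p))) m∉u
insert-injective m∉t m∉u (right {l} p) (left q) =
  contradiction (there (∈-++⁺ˡ (inserted∈labels q))) m∉t

no-labels : ∀ {m t} → All (m <_) (labels t) → All (_≤ m) (labels t) → t ≡ empty
no-labels {t = empty}      _         _         = refl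
no-labels {t = node _ _ _} (m<k ∷ _) (k≤m ∷ _) = contradiction k≤m (<⇒≱ m<k)

-- A largest label sits at a leaf, because any descendant would carry a larger one; removing that
-- leaf undoes an insertion.
uninsert : ∀ {m t} → Increasing t → All (_≤ m) (labels t) → m ∈ labels t →
           ∃[ u ] Insert m u t
uninsert {t = node l k r} (node m<l m<r _ _) (_ ∷ ≤m) (here refl)
  with refl ← no-labels {t = l} m<l (++⁻ˡ (labels l) ≤m)
     | refl ← no-labels {t = r} m<r (++⁻ʳ (labels l) ≤m) = empty , slot
uninsert {t = node l k r} (node _ _ il ir) (_ ∷ ≤m) (there m∈) with ∈-++⁻ (labels l) m∈
... | inj₁ m∈l with l₀ , p ← uninsert il (++⁻ˡ (labels l) ≤m) m∈l = node l₀ k r , left p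
... | inj₂ m∈r with r₀ , p ← uninsert ir (++⁻ʳ (labels l) ≤m) m∈r = node l k r₀ , right p

insert-irrefl : ∀ {m t} → ¬ Insert m t t
insert-irrefl p = <⇒≢ ≤-refl (↭-length (insert-labels p))

insertions-unique : ∀ m t → Unique (insertions m t)
insertions-unique m empty        = [] ∷ []
insertions-unique m (node l k r) =
  Unique.++⁺ (Unique.map⁺ (λ { refl → refl }) (insertions-unique m l))
             (Unique.map⁺ (λ { refl → refl }) (insertions-unique m r))
             disjoint
  where
  disjoint : Disjoint (map (λ l′ → node l′ k r) (insertions m l)) (map (node l k) (insertions m r))
  -- A common element would have `l` itself as its left subtree, making `l` the result of an
  -- insertion into `l`.
  disjoint (∈ˡ , ∈ʳ)
    with _ , l∈ , refl ← ∈-map⁻ _ ∈ˡ | _ , _ , refl ← ∈-map⁻ _ ∈ʳ =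
    insert-irrefl (∈-insertions⁻ l l∈)

-- Increasing trees of size n + 1 as insertions into those of size n.

max∈ : ∀ {n xs} → Unique xs → length xs ≡ suc n → All (λ k → 1 ≤ k × k ≤ suc n) xs → suc n ∈ xs
max∈ {n} {xs} u len range with _∈?_ _≟_ (suc n) xs
... | yes n∈ = n∈
-- Pigeonhole: without `suc n`, the `suc n` distinct entries would all lie in `[1⋯ n ]`.
... | no n∉ = contradiction (unique⊆⇒length≤ u xs⊆[1⋯n]) (<⇒≱ (begin-strict
    length [1⋯ n ]   ≡⟨ length-applyUpTo suc n ⟩
    n                <⟨ ≤-refl ⟩
    suc n            ≡⟨ len ⟨
    length xs        ∎))
  where
  open ≤-Reasoning
  xs⊆[1⋯n] : xs ⊆ [1⋯ n ]
  xs⊆[1⋯n] {zero}  k∈ with () ← proj₁ (All.lookup range k∈)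
  xs⊆[1⋯n] {suc k} k∈ = ∈-applyUpTo⁺ suc
    (≤-pred (≤∧≢⇒< (proj₂ (All.lookup range k∈)) (λ { refl → n∉ k∈ })))

∉-labels : ∀ {n t} → IsIncreasingTree n t → suc n ∉ labels t
∉-labels i n∈ = <⇒≱ ≤-refl (proj₂ (All.lookup (IsIncreasingTree.inRange i) n∈))

isIncreasingTree-insert : ∀ {n t t′} → IsIncreasingTree n t → Insert (suc n) t t′ →
                          IsIncreasingTree (suc n) t′
isIncreasingTree-insert {n} {t} i p = mkIsIncreasingTree
  (trans (↭-length σ) (cong suc size≡n))
  (Permutationₛ.Unique-resp-↭ (setoid ℕ) (↭⇒↭ₛ (↭-sym σ))
    (All.tabulate (λ { k∈ refl → ∉-labels i k∈ }) ∷ distinct))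
  (All-resp-↭ (↭-sym σ)
    ((s≤s z≤n , ≤-refl) ∷ All.map (λ (1≤k , k≤n) → 1≤k , m≤n⇒m≤1+n k≤n) inRange))
  (insert-increasing⁺ p (All.map (s≤s ∘ proj₂) inRange) increasing)
  where
  open IsIncreasingTree i
  σ = insert-labels p

isIncreasingTree-uninsert : ∀ {n t′} → IsIncreasingTree (suc n) t′ →
                            ∃[ t ] IsIncreasingTree n t × Insert (suc n) t t′
isIncreasingTree-uninsert {n} i
  with t , p ← uninsert (IsIncreasingTree.increasing i)
                        (All.map proj₂ (IsIncreasingTree.inRange i))
                        (let open IsIncreasingTree i in max∈ distinct size≡n inRange)
  with n∉ ∷ u ← Permutationₛ.Unique-resp-↭ (setoid ℕ) (↭⇒↭ₛ (insert-labels p))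
                  (IsIncreasingTree.distinct i)
     | _ ∷ range ← All-resp-↭ (insert-labels p) (IsIncreasingTree.inRange i) =
  t , mkIsIncreasingTree
        (suc-injective (trans (sym (↭-length (insert-labels p))) (IsIncreasingTree.size≡n i)))
        u
        -- Distinctness excludes a second `suc n`, so the remaining labels are at most `n`.
        (All.zipWith (λ { (n≢k , 1≤k , k≤1+n) → 1≤k , ≤-pred (≤∧≢⇒< k≤1+n (n≢k ∘ sym)) })
                     (n∉ , range))
        (insert-increasing⁻ p (IsIncreasingTree.increasing i))
    , p

concatMap-unique : ∀ {f : A → List B} {xs} → (∀ x → Unique (f x)) →
                   (∀ {x y z} → x ∈ xs → y ∈ xs → z ∈ f x → z ∈ f y → x ≡ y) →
                   Unique xs → Unique (concatMap f xs)
concatMap-unique {xs = []}     _ _   _        = []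
concatMap-unique {f = f} {xs = x ∷ xs} uf inj (x∉ ∷ u) =
  Unique.++⁺ (uf x) (concatMap-unique uf (λ x∈ y∈ → inj (there x∈) (there y∈)) u)
    λ (z∈ , z∈′) → case find (∈-concatMap⁻ f {xs = xs} z∈′) of λ (y , y∈ , z∈y) →
      All.lookup x∉ y∈ (inj (here refl) (there y∈) z∈ z∈y)

-- Neither list has repetitions, so having the same elements already makes them permutations of each
-- other. Repetition-freeness on the right is the injectivity of insertion; the two inclusions are
-- insertion and removal of the largest label.
increasingTrees-suc : ∀ n →
  increasingTrees (suc n) ↭ concatMap (insertions (suc n)) (increasingTrees n)
increasingTrees-suc n = ∼bag⇒↭ (unique∧set⇒bag
  (increasingTrees-unique (suc n))
  (concatMap-unique (insertions-unique (suc n))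
    (λ {t} {u} t∈ u∈ p q → insert-injective (∉-labels (⇒ t∈)) (∉-labels (⇒ u∈))
                             (∈-insertions⁻ t p) (∈-insertions⁻ u q))
    (increasingTrees-unique n))
  (mk⇔ to from))
  where
  ⇒ : ∀ {n t} → t ∈ increasingTrees n → IsIncreasingTree n t
  ⇒ = Equivalence.to ∈-increasingTrees
  ⇐ : ∀ {n t} → IsIncreasingTree n t → t ∈ increasingTrees n
  ⇐ = Equivalence.from ∈-increasingTrees
  to : ∀ {t′} → t′ ∈ increasingTrees (suc n) →
       t′ ∈ concatMap (insertions (suc n)) (increasingTrees n)
  to t′∈ with _ , i , p ← isIncreasingTree-uninsert (⇒ t′∈) =
    ∈-concatMap⁺ (insertions (suc n)) (lose (⇐ i) (∈-insertions⁺ p))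
  from : ∀ {t′} → t′ ∈ concatMap (insertions (suc n)) (increasingTrees n) →
         t′ ∈ increasingTrees (suc n)
  from t′∈ with t , t∈ , p ← find (∈-concatMap⁻ (insertions (suc n)) {xs = increasingTrees n} t′∈) =
    ⇐ (isIncreasingTree-insert (⇒ t∈) (∈-insertions⁻ t p))

Σ-increasingTrees-suc : ∀ n (f : Tree → ℕ) →
  Σ (increasingTrees (suc n)) f ≡ Σ (increasingTrees n) (λ t → Σ (insertions (suc n) t) f)
Σ-increasingTrees-suc n f =
  trans (sum-↭ (map⁺ f (increasingTrees-suc n)))
        (Σ-concatMap f (insertions (suc n)) (increasingTrees n))

-- Sizes, and the number of insertions.

size : Shape → ℕ
size empty      = 0
size (node l r) = suc (size l + size r)

size-shape : ∀ t → size (shape t) ≡ length (labels t)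
size-shape empty        = refl
size-shape (node l _ r) =
  cong suc (trans (cong₂ _+_ (size-shape l) (size-shape r)) (sym (length-++ (labels l))))

size-increasingTree : ∀ {n t} → t ∈ increasingTrees n → size (shape t) ≡ n
size-increasingTree {t = t} t∈ =
  trans (size-shape t) (IsIncreasingTree.size≡n (Equivalence.to ∈-increasingTrees t∈))

size-insertion : ∀ {m t t′} → Insert m t t′ → size (shape t′) ≡ suc (size (shape t))
size-insertion {t = t} {t′} p =
  trans (size-shape t′) (trans (↭-length (insert-labels p)) (cong suc (sym (size-shape t))))

length-insertions : ∀ m t → length (insertions m t) ≡ suc (size (shape t))
length-insertions m empty        = refl
length-insertions m (node l k r) = begin
  length (map _ (insertions m l) ++ map _ (insertions m r))
    ≡⟨ length-++ (map _ (insertions m l)) ⟩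
  length (map _ (insertions m l)) + length (map _ (insertions m r))
    ≡⟨ cong₂ _+_ (length-map _ (insertions m l)) (length-map _ (insertions m r)) ⟩
  length (insertions m l) + length (insertions m r)
    ≡⟨ cong₂ _+_ (length-insertions m l) (length-insertions m r) ⟩
  suc (size (shape l)) + suc (size (shape r))
    ≡⟨ cong suc (+-suc (size (shape l)) (size (shape r))) ⟩
  suc (suc (size (shape l) + size (shape r)))  ∎
  where open ≡-Reasoning

-- Each tree of size `n` has `suc n` empty slots. This is the recursion of the factorial.
length-increasingTrees-suc : ∀ n →
  length (increasingTrees (suc n)) ≡ suc n * length (increasingTrees n)
length-increasingTrees-suc n = begin
  length (increasingTrees (suc n))                              ≡⟨ Σ-1 (increasingTrees (suc n)) ⟨
  Σ (increasingTrees (suc n)) (λ _ → 1)                         ≡⟨ Σ-increasingTrees-suc n _ ⟩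
  Σ (increasingTrees n) (λ t → Σ (insertions (suc n) t) λ _ → 1)
    ≡⟨ Σ-cong (increasingTrees n) (λ {t} t∈ → trans (Σ-1 (insertions (suc n) t))
         (trans (length-insertions (suc n) t) (cong suc (size-increasingTree t∈)))) ⟩
  Σ (increasingTrees n) (λ _ → suc n)                           ≡⟨ Σ-const (suc n) (increasingTrees n) ⟩
  length (increasingTrees n) * suc n                            ≡⟨ *-comm (length (increasingTrees n)) (suc n) ⟩
  suc n * length (increasingTrees n)                            ∎
  where open ≡-Reasoning

-- Fringe subtrees of size at least k, and their growth under insertion.

𝟙[_≤_] : ℕ → ℕ → ℕ
𝟙[ zero  ≤ n     ] = 1
𝟙[ suc m ≤ zero  ] = 0
𝟙[ suc m ≤ suc n ] = 𝟙[ m ≤ n ]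

𝟙≡1 : ∀ {m n} → m ≤ n → 𝟙[ m ≤ n ] ≡ 1
𝟙≡1 z≤n     = refl
𝟙≡1 (s≤s p) = 𝟙≡1 p

𝟙≡0 : ∀ {m n} → n < m → 𝟙[ m ≤ n ] ≡ 0
𝟙≡0 {suc m} {zero}  _       = refl
𝟙≡0 {suc m} {suc n} (s≤s p) = 𝟙≡0 p

-- The empty slots count as fringe subtrees of size 0.
fringe≥ : ℕ → Shape → ℕ
fringe≥ k empty        = 𝟙[ k ≤ 0 ]
fringe≥ k s@(node l r) = 𝟙[ k ≤ size s ] + (fringe≥ k l + fringe≥ k r)

fringe≥0 : ∀ s → fringe≥ 0 s ≡ suc (2 * size s)
fringe≥0 empty      = refl
fringe≥0 (node l r) =
  trans (cong suc (cong₂ _+_ (fringe≥0 l) (fringe≥0 r))) (lemma (size l) (size r))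
  where
  lemma : ∀ a b → suc (suc (2 * a) + suc (2 * b)) ≡ suc (2 * suc (a + b))
  lemma = solve-∀

fringe≥-small : ∀ {k} s → size s < k → fringe≥ k s ≡ 0
fringe≥-small empty      0<k = 𝟙≡0 0<k
fringe≥-small (node l r) s<k = cong₂ _+_ (𝟙≡0 s<k)
  (cong₂ _+_ (fringe≥-small l (≤-<-trans (m≤n⇒m≤1+n (m≤m+n (size l) (size r))) s<k))
             (fringe≥-small r (≤-<-trans (m≤n⇒m≤1+n (m≤n+m (size r) (size l))) s<k)))

-- The share of the root in the insertion identity for a tree of size `suc n`. The two indicators
-- differ only at `k = suc n`, and there the coefficients `suc (suc n)` and `suc k` coincide.
𝟙-exchange : ∀ k n → suc (suc n) * 𝟙[ k ≤ suc n ] + suc k * 𝟙[ k ≤ n ] ≡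
                     suc (suc n) * 𝟙[ k ≤ n ] + suc k * 𝟙[ k ≤ suc n ]
𝟙-exchange k n with <-cmp k (suc n)
... | tri< k<1+n _ _ rewrite 𝟙≡1 (<⇒≤ k<1+n) | 𝟙≡1 (≤-pred k<1+n) = refl
... | tri≈ _ refl _ = +-comm (suc k * 𝟙[ k ≤ k ]) (suc k * 𝟙[ k ≤ n ])
... | tri> _ _ 1+n<k rewrite 𝟙≡0 1+n<k | 𝟙≡0 (<-trans ≤-refl 1+n<k) =
  trans (cong₂ _+_ (*-zeroʳ n) (*-zeroʳ k)) (sym (cong₂ _+_ (*-zeroʳ n) (*-zeroʳ k)))

-- A fringe subtree of size j is enlarged by j + 1 of the insertions, so the subtrees that
-- reach size k + 1 are those of size exactly k, and each of them does so k + 1 times.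
Σ-insertions-fringe≥ : ∀ m k t →
  Σ (insertions m t) (fringe≥ (suc k) ∘ shape) + suc k * fringe≥ (suc k) (shape t) ≡
  suc (size (shape t)) * fringe≥ (suc k) (shape t) + suc k * fringe≥ k (shape t)
Σ-insertions-fringe≥ m zero    empty = refl
Σ-insertions-fringe≥ m (suc k) empty = refl
Σ-insertions-fringe≥ m k (node l x r) = begin
  Σ (map (λ l′ → node l′ x r) (insertions m l) ++ map (node l x) (insertions m r)) G + suc k * (i + (gl + gr))
    ≡⟨ cong (_+ suc k * (i + (gl + gr))) (Σ-++ G (map (λ l′ → node l′ x r) (insertions m l)) _) ⟩
  Σ (map (λ l′ → node l′ x r) (insertions m l)) G + Σ (map (node l x) (insertions m r)) G + suc k * (i + (gl + gr))
    ≡⟨ cong (_+ suc k * (i + (gl + gr))) (cong₂ _+_ left-sum right-sum) ⟩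
  (a * (j + gr) + Sl) + (b * (j + gl) + Sr) + suc k * (i + (gl + gr))
    -- The root and the two subtrees each get their own instance of the identity. The cross terms
    -- `a * gr` and `b * gl` come from the subtree on the side that an insertion leaves unchanged.
    ≡⟨ regroup a b (suc k) i j gl gr Sl Sr ⟩
  ((a + b) * j + suc k * i) + (Sl + suc k * gl) + (Sr + suc k * gr) + (a * gr + b * gl)
    ≡⟨ cong (_+ (a * gr + b * gl)) (cong₂ _+_ (cong₂ _+_ exchange (Σ-insertions-fringe≥ m k l)) (Σ-insertions-fringe≥ m k r)) ⟩
  ((a + b) * i + suc k * j) + (a * gl + suc k * hl) + (b * gr + suc k * hr) + (a * gr + b * gl)
    ≡⟨ collect a b (suc k) i j gl gr hl hr ⟩
  (a + b) * (i + (gl + gr)) + suc k * (j + (hl + hr))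
    ≡⟨ cong (λ z → z * (i + (gl + gr)) + suc k * (j + (hl + hr))) a+b ⟩
  suc (suc n) * (i + (gl + gr)) + suc k * (j + (hl + hr)) ∎
  where
  open ≡-Reasoning
  G : Tree → ℕ
  G = fringe≥ (suc k) ∘ shape
  a = suc (size (shape l))
  b = suc (size (shape r))
  n = size (shape l) + size (shape r)
  -- The root's indicators before and after an insertion, `𝟙[ suc k ≤ suc n ]` and
  -- `𝟙[ suc k ≤ suc (suc n) ]`, compute to `i` and `j`.
  i = 𝟙[ k ≤ n ]
  j = 𝟙[ k ≤ suc n ]
  gl = G l
  gr = G r
  hl = fringe≥ k (shape l)
  hr = fringe≥ k (shape r)
  Sl = Σ (insertions m l) G
  Sr = Σ (insertions m r) G

  a+b : a + b ≡ suc (suc n)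
  a+b = cong suc (+-suc (size (shape l)) (size (shape r)))

  exchange : (a + b) * j + suc k * i ≡ (a + b) * i + suc k * j
  exchange = subst (λ z → z * j + suc k * i ≡ z * i + suc k * j) (sym a+b) (𝟙-exchange k n)

  Σ-affine : ∀ c (f : Tree → ℕ) ts → Σ ts (λ t → c + f t) ≡ length ts * c + Σ ts f
  Σ-affine c f ts = trans (Σ-+ (λ _ → c) f ts) (cong (_+ Σ ts f) (Σ-const c ts))

  swapʳ : ∀ x y z → x + (y + z) ≡ (x + z) + y
  swapʳ = solve-∀

  left-sum : Σ (map (λ l′ → node l′ x r) (insertions m l)) G ≡ a * (j + gr) + Sl
  left-sum = begin
    Σ (map (λ l′ → node l′ x r) (insertions m l)) G
      ≡⟨ Σ-map G _ (insertions m l) ⟩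
    Σ (insertions m l) (λ l′ → G (node l′ x r))
      ≡⟨ Σ-cong (insertions m l) (λ {l′} l′∈ → trans
           (cong (λ z → 𝟙[ k ≤ z + size (shape r) ] + (G l′ + gr)) (size-insertion (∈-insertions⁻ l l′∈)))
           (swapʳ j (G l′) gr)) ⟩
    Σ (insertions m l) (λ l′ → (j + gr) + G l′)
      ≡⟨ Σ-affine (j + gr) G (insertions m l) ⟩
    length (insertions m l) * (j + gr) + Sl
      ≡⟨ cong (λ z → z * (j + gr) + Sl) (length-insertions m l) ⟩
    a * (j + gr) + Sl ∎

  right-sum : Σ (map (node l x) (insertions m r)) G ≡ b * (j + gl) + Sr
  right-sum = begin
    Σ (map (node l x) (insertions m r)) G
      ≡⟨ Σ-map G _ (insertions m r) ⟩
    Σ (insertions m r) (λ r′ → G (node l x r′))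
      ≡⟨ Σ-cong (insertions m r) (λ {r′} r′∈ → trans
           (cong (λ z → 𝟙[ k ≤ z ] + (gl + G r′))
             (trans (cong (_+_ (size (shape l))) (size-insertion (∈-insertions⁻ r r′∈)))
                    (+-suc (size (shape l)) (size (shape r)))))
           (sym (+-assoc j gl (G r′)))) ⟩
    Σ (insertions m r) (λ r′ → (j + gl) + G r′)
      ≡⟨ Σ-affine (j + gl) G (insertions m r) ⟩
    length (insertions m r) * (j + gl) + Sr
      ≡⟨ cong (λ z → z * (j + gl) + Sr) (length-insertions m r) ⟩
    b * (j + gl) + Sr ∎

  regroup : ∀ a b k i j gl gr Sl Sr →
    (a * (j + gr) + Sl) + (b * (j + gl) + Sr) + k * (i + (gl + gr)) ≡
    ((a + b) * j + k * i) + (Sl + k * gl) + (Sr + k * gr) + (a * gr + b * gl)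
  regroup = solve-∀

  collect : ∀ a b k i j gl gr hl hr →
    ((a + b) * i + k * j) + (a * gl + k * hl) + (b * gr + k * hr) + (a * gr + b * gl) ≡
    (a + b) * (i + (gl + gr)) + k * (j + (hl + hr))
  collect = solve-∀

-- Totals over all increasing trees.

totalFringe≥ : ℕ → ℕ → ℕ
totalFringe≥ k n = Σ (increasingTrees n) (fringe≥ k ∘ shape)

totalFringe≥-suc : ∀ k n →
  totalFringe≥ (suc k) (suc n) + suc k * totalFringe≥ (suc k) n ≡
  suc n * totalFringe≥ (suc k) n + suc k * totalFringe≥ k n
totalFringe≥-suc k n = begin
  totalFringe≥ (suc k) (suc n) + suc k * Σ ts G
    ≡⟨ cong₂ _+_ (Σ-increasingTrees-suc n G) (sym (Σ-* (suc k) G ts)) ⟩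
  Σ ts (λ t → Σ (insertions (suc n) t) G) + Σ ts (λ t → suc k * G t)
    ≡⟨ Σ-+ (λ t → Σ (insertions (suc n) t) G) (λ t → suc k * G t) ts ⟨
  Σ ts (λ t → Σ (insertions (suc n) t) G + suc k * G t)
    ≡⟨ Σ-cong ts (λ {t} t∈ → trans (Σ-insertions-fringe≥ (suc n) k t)
         (cong (λ z → suc z * G t + suc k * H t) (size-increasingTree {n} t∈))) ⟩
  Σ ts (λ t → suc n * G t + suc k * H t)
    ≡⟨ Σ-+ (λ t → suc n * G t) (λ t → suc k * H t) ts ⟩
  Σ ts (λ t → suc n * G t) + Σ ts (λ t → suc k * H t)
    ≡⟨ cong₂ _+_ (Σ-* (suc n) G ts) (Σ-* (suc k) H ts) ⟩
  suc n * Σ ts G + suc k * Σ ts H ∎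
  where
  open ≡-Reasoning
  ts = increasingTrees n
  G H : Tree → ℕ
  G = fringe≥ (suc k) ∘ shape
  H = fringe≥ k ∘ shape

totalFringe≥0 : ∀ n → totalFringe≥ 0 n ≡ suc (2 * n) * length (increasingTrees n)
totalFringe≥0 n = begin
  totalFringe≥ 0 n
    ≡⟨ Σ-cong (increasingTrees n) (λ {t} t∈ →
         trans (fringe≥0 (shape t)) (cong (λ z → suc (2 * z)) (size-increasingTree {n} t∈))) ⟩
  Σ (increasingTrees n) (λ _ → suc (2 * n))      ≡⟨ Σ-const (suc (2 * n)) (increasingTrees n) ⟩
  length (increasingTrees n) * suc (2 * n)       ≡⟨ *-comm (length (increasingTrees n)) (suc (2 * n)) ⟩
  suc (2 * n) * length (increasingTrees n)       ∎
  where open ≡-Reasoning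

totalFringe≥-large : ∀ {k n} → n < k → totalFringe≥ k n ≡ 0
totalFringe≥-large {k} {n} n<k = begin
  totalFringe≥ k n
    ≡⟨ Σ-cong (increasingTrees n) (λ {t} t∈ →
         fringe≥-small (shape t) (subst (_< k) (sym (size-increasingTree t∈)) n<k)) ⟩
  Σ (increasingTrees n) (λ _ → 0)        ≡⟨ Σ-const 0 (increasingTrees n) ⟩
  length (increasingTrees n) * 0         ≡⟨ *-zeroʳ (length (increasingTrees n)) ⟩
  0                                      ∎
  where open ≡-Reasoning

-- Induction on `n` with `k` varying. If `k` exceeds `n`, the total vanishes; otherwise the
-- recurrence expresses it through totals at the previous size with nonnegative coefficients, so
-- upper bounds carry over.
totalFringe≥-bound : ∀ k n →
  suc k * totalFringe≥ k n ≤ 2 * suc n * length (increasingTrees n)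
totalFringe≥-bound zero n = begin
  1 * totalFringe≥ 0 n                              ≡⟨ *-identityˡ _ ⟩
  totalFringe≥ 0 n                                  ≡⟨ totalFringe≥0 n ⟩
  suc (2 * n) * length (increasingTrees n)          ≤⟨ *-monoˡ-≤ (length (increasingTrees n)) 1+2n≤2+2n ⟩
  2 * suc n * length (increasingTrees n)            ∎
  where
  open ≤-Reasoning
  1+2n≤2+2n : suc (2 * n) ≤ 2 * suc n
  1+2n≤2+2n = ≤-trans (n≤1+n _) (≤-reflexive (sym (*-suc 2 n)))
totalFringe≥-bound (suc k) zero = ≤-trans
  (≤-reflexive (trans (cong (suc (suc k) *_) (totalFringe≥-large {suc k} {0} (s≤s z≤n)))
                      (*-zeroʳ (suc (suc k)))))
  z≤n
totalFringe≥-bound (suc k) (suc n) with suc k ≤? suc n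
... | no k≰n = ≤-trans
  (≤-reflexive (trans (cong (suc (suc k) *_) (totalFringe≥-large (≰⇒> k≰n)))
                      (*-zeroʳ (suc (suc k)))))
  z≤n
... | yes k≤n = begin
  suc (suc k) * totalFringe≥ (suc k) (suc n)
    -- Because `suc k ≤ suc n`, the subtraction in `d` is exact, and
    -- `suc k * totalFringe≥ (suc k) n` can be cancelled from the recurrence.
    ≡⟨ cong (suc (suc k) *_) recurrence ⟩
  suc (suc k) * (d * totalFringe≥ (suc k) n + suc k * totalFringe≥ k n)
    ≡⟨ distribute (suc k) d (totalFringe≥ (suc k) n) (totalFringe≥ k n) ⟩
  d * (suc (suc k) * totalFringe≥ (suc k) n) + suc (suc k) * (suc k * totalFringe≥ k n)
    ≤⟨ +-mono-≤ (*-monoʳ-≤ d (totalFringe≥-bound (suc k) n))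
                (*-monoʳ-≤ (suc (suc k)) (totalFringe≥-bound k n)) ⟩
  d * (2 * suc n * N) + suc (suc k) * (2 * suc n * N)
    ≡⟨ factor (suc n) (suc k) d N ⟩
  2 * suc (suc k + d) * (suc n * N)
    -- The weights `d` and `suc (suc k)` add up to `suc (suc n)`, and `suc n * N` is the number of
    -- trees of the next size.
    ≡⟨ cong₂ (λ x y → 2 * suc x * y) (m+[n∸m]≡n k≤n) (sym (length-increasingTrees-suc n)) ⟩
  2 * suc (suc n) * length (increasingTrees (suc n)) ∎
  where
  open ≤-Reasoning
  N = length (increasingTrees n)
  d = suc n ∸ suc k

  distribute : ∀ k d x y → suc k * (d * x + k * y) ≡ d * (suc k * x) + suc k * (k * y)
  distribute = solve-∀

  factor : ∀ n k d z → d * (2 * n * z) + suc k * (2 * n * z) ≡ 2 * suc (k + d) * (n * z)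
  factor = solve-∀

  split : ∀ k d x y → (k + d) * x + y ≡ (d * x + y) + k * x
  split = solve-∀

  recurrence : totalFringe≥ (suc k) (suc n) ≡ d * totalFringe≥ (suc k) n + suc k * totalFringe≥ k n
  recurrence = +-cancelʳ-≡ (suc k * totalFringe≥ (suc k) n) _ _
    (trans (totalFringe≥-suc k n)
    (trans (cong (λ z → z * totalFringe≥ (suc k) n + suc k * totalFringe≥ k n) (sym (m+[n∸m]≡n k≤n)))
           (split (suc k) d (totalFringe≥ (suc k) n) (suc k * totalFringe≥ k n))))

-- Counting small shapes by binary codes.

-- Reading the preorder code of a shape from right to left builds it on top of a stack.
reduce : List Shape → List Shape
reduce (l ∷ r ∷ st) = node l r ∷ st
reduce st           = st

-- One entry for each binary word of length `m`. Words that code no shape are kept, with `reduce`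
-- acting as the identity on stacks that are too short, so that there are exactly `2 ^ m` entries.
stacks : ℕ → List (List Shape)
stacks zero    = [ [] ]
stacks (suc m) = map (empty ∷_) (stacks m) ++ map reduce (stacks m)

length-stacks : ∀ m → length (stacks m) ≡ 2 ^ m
length-stacks zero    = refl
length-stacks (suc m) = begin
  length (map (empty ∷_) (stacks m) ++ map reduce (stacks m))
    ≡⟨ length-++ (map (empty ∷_) (stacks m)) ⟩
  length (map (empty ∷_) (stacks m)) + length (map reduce (stacks m))
    ≡⟨ cong₂ _+_ (trans (length-map _ (stacks m)) (length-stacks m))
                 (trans (length-map _ (stacks m)) (length-stacks m)) ⟩
  2 ^ m + 2 ^ m
    ≡⟨ cong (_+_ (2 ^ m)) (+-identityʳ (2 ^ m)) ⟨
  2 ^ suc m ∎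
  where open ≡-Reasoning

-- A shape with j nodes has j + 1 empty slots, hence a code of length 2j + 1. The right subtree is
-- built first, which leaves the left one on top for `reduce`.
∈-stacks : ∀ s {st m} → st ∈ stacks m → s ∷ st ∈ stacks (suc (2 * size s) + m)
∈-stacks empty      st∈ = ∈-++⁺ˡ (∈-map⁺ _ st∈)
∈-stacks (node l r) {st} {m} st∈ = subst (λ z → node l r ∷ st ∈ stacks z)
  (lengths (size l) (size r) m)
  (∈-++⁺ʳ (map (empty ∷_) (stacks (suc (2 * size l) + (suc (2 * size r) + m))))
    (∈-map⁺ reduce (∈-stacks l (∈-stacks r st∈))))
  where
  lengths : ∀ a b m → suc (suc (2 * a) + (suc (2 * b) + m)) ≡ suc (2 * suc (a + b)) + m
  lengths = solve-∀

-- Provides padding underneath a shape, which brings shorter codes to a common length.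
stacks-inhabited : ∀ m → ∃[ st ] st ∈ stacks m
stacks-inhabited zero    = [] , here refl
stacks-inhabited (suc m) with st , st∈ ← stacks-inhabited m =
  empty ∷ st , ∈-++⁺ˡ (∈-map⁺ _ st∈)

top : List Shape → Shape
top []      = empty
top (s ∷ _) = s

-- Sizes below `k` have codes of length at most `2 * k ∸ 1`, padded here to `2 * k`. Larger shapes,
-- repetitions and the default of `top` may also occur, as the list serves only as an upper bound.
shapes< : ℕ → List Shape
shapes< k = map top (stacks (2 * k))

∈-shapes< : ∀ {k} s → size s < k → s ∈ shapes< k
∈-shapes< {k} s s<k with st , st∈ ← stacks-inhabited (2 * k ∸ suc (2 * size s)) =
  ∈-map⁺ top (subst (λ z → s ∷ st ∈ stacks z) (m+[n∸m]≡n 1+2s≤2k) (∈-stacks s st∈))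
  where
  1+2s≤2k : suc (2 * size s) ≤ 2 * k
  1+2s≤2k = *-monoʳ-< 2 s<k

length-shapes< : ∀ k → length (shapes< k) ≡ 2 ^ (2 * k)
length-shapes< k = trans (length-map top (stacks (2 * k))) (length-stacks (2 * k))

-- Bounding the compacted size at a threshold k.

largeFringe : ℕ → Tree → List Shape
largeFringe k t = filter (λ s → k ≤? size s) (map shape (fringeSubtrees t))

-- Equality can fail only at `k = 0`, where `fringe≥` counts the empty slots as well.
length-largeFringe : ∀ k t → length (largeFringe k t) ≤ fringe≥ k (shape t)
length-largeFringe k empty = z≤n
length-largeFringe k t@(node l x r) = begin
  length (largeFringe k t)
    ≤⟨ head (map shape (fringeSubtrees l ++ fringeSubtrees r)) ⟩
  i + length (filter P? (map shape (fringeSubtrees l ++ fringeSubtrees r)))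
    ≡⟨ cong (λ z → i + length z) (trans (cong (filter P?) (map-++ shape (fringeSubtrees l) _))
                                       (filter-++ P? (map shape (fringeSubtrees l)) _)) ⟩
  i + length (largeFringe k l ++ largeFringe k r)
    ≡⟨ cong (i +_) (length-++ (largeFringe k l)) ⟩
  i + (length (largeFringe k l) + length (largeFringe k r))
    ≤⟨ +-monoʳ-≤ i (+-mono-≤ (length-largeFringe k l) (length-largeFringe k r)) ⟩
  i + (fringe≥ k (shape l) + fringe≥ k (shape r)) ∎
  where
  open ≤-Reasoning
  P? = λ s → k ≤? size s
  i = 𝟙[ k ≤ size (shape t) ]
  head : ∀ ss → length (filter P? (shape t ∷ ss)) ≤ i + length (filter P? ss)
  head ss with k ≤? size (shape t)
  ... | yes k≤ = ≤-reflexive (trans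
    (cong length (filter-accept P? {shape t} {ss} k≤))
    (cong (_+ length (filter P? ss)) (sym (𝟙≡1 k≤))))
  ... | no k≰ = ≤-trans (≤-reflexive (cong length (filter-reject P? {shape t} {ss} k≰)))
    (m≤n+m _ i)

compactedSize-bound : ∀ k t → compactedSize t ≤ 2 ^ (2 * k) + fringe≥ k (shape t)
compactedSize-bound k t = begin
  compactedSize t
    ≤⟨ unique⊆⇒length≤ (deduplicate-! (map shape (fringeSubtrees t))) cover ⟩
  length (shapes< k ++ largeFringe k t)
    ≡⟨ length-++ (shapes< k) ⟩
  length (shapes< k) + length (largeFringe k t)
    ≤⟨ +-mono-≤ (≤-reflexive (length-shapes< k)) (length-largeFringe k t) ⟩
  2 ^ (2 * k) + fringe≥ k (shape t) ∎
  where
  open ≤-Reasoning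
  cover : deduplicate _≟ˢ_ (map shape (fringeSubtrees t)) ⊆ shapes< k ++ largeFringe k t
  cover {s} s∈ with k ≤? size s
  ... | yes k≤s = ∈-++⁺ʳ (shapes< k)
                    (∈-filter⁺ (λ s → k ≤? size s) (∈-deduplicate⁻ _≟ˢ_ _ s∈) k≤s)
  ... | no k≰s  = ∈-++⁺ˡ (∈-shapes< s (≰⇒> k≰s))

-- The factor `suc k` clears the denominator of the bound on `totalFringe≥ k n`.
Σ-compactedSize : ∀ k n → suc k * Σ (increasingTrees n) compactedSize ≤
  (suc k * 2 ^ (2 * k) + 2 * suc n) * length (increasingTrees n)
Σ-compactedSize k n = begin
  suc k * Σ (increasingTrees n) compactedSize
    ≤⟨ *-monoʳ-≤ (suc k) (Σ-mono (increasingTrees n) (λ {t} _ → compactedSize-bound k t)) ⟩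
  suc k * Σ (increasingTrees n) (λ t → 2 ^ (2 * k) + fringe≥ k (shape t))
    ≡⟨ cong (suc k *_) (trans (Σ-+ (λ _ → 2 ^ (2 * k)) (fringe≥ k ∘ shape) (increasingTrees n))
         (cong (_+ totalFringe≥ k n) (Σ-const (2 ^ (2 * k)) (increasingTrees n)))) ⟩
  suc k * (N * 2 ^ (2 * k) + totalFringe≥ k n)
    ≡⟨ *-distribˡ-+ (suc k) (N * 2 ^ (2 * k)) (totalFringe≥ k n) ⟩
  suc k * (N * 2 ^ (2 * k)) + suc k * totalFringe≥ k n
    ≤⟨ +-monoʳ-≤ (suc k * (N * 2 ^ (2 * k))) (totalFringe≥-bound k n) ⟩
  suc k * (N * 2 ^ (2 * k)) + 2 * suc n * N
    ≡⟨ factor (suc k) (2 ^ (2 * k)) (2 * suc n) N ⟩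
  (suc k * 2 ^ (2 * k) + 2 * suc n) * N ∎
  where
  open ≤-Reasoning
  N = length (increasingTrees n)
  factor : ∀ k p m z → k * (z * p) + m * z ≡ (k * p + m) * z
  factor = solve-∀

-- Choosing a threshold of logarithmic order.

2^⌊log₂n⌋≤n : ∀ n .{{_ : NonZero n}} → 2 ^ ⌊log₂ n ⌋ ≤ n
2^⌊log₂n⌋≤n (suc n) = <-rec (λ n → 2 ^ ⌊log₂ suc n ⌋ ≤ suc n) step n
  where
  open ≤-Reasoning
  2*⌊n/2⌋≤n : ∀ n → 2 * ⌊ n /2⌋ ≤ n
  2*⌊n/2⌋≤n zero          = z≤n
  2*⌊n/2⌋≤n (suc zero)    = z≤n
  2*⌊n/2⌋≤n (suc (suc n)) = ≤-trans (≤-reflexive (*-suc 2 ⌊ n /2⌋)) (s≤s (s≤s (2*⌊n/2⌋≤n n)))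
  step : ∀ n → (∀ {m} → m < n → 2 ^ ⌊log₂ suc m ⌋ ≤ suc m) → 2 ^ ⌊log₂ suc n ⌋ ≤ suc n
  step zero    _  = ≤-refl
  step (suc n) ih = begin
    2 ^ ⌊log₂ suc (suc n) ⌋
      -- Halving lowers the logarithm by one. The inequality `L ≤ 1 + (L ∸ 1)` avoids a separate
      -- proof that the logarithm is positive.
      ≤⟨ ^-monoʳ-≤ 2 (m≤n+m∸n ⌊log₂ suc (suc n) ⌋ 1) ⟩
    2 * 2 ^ (⌊log₂ suc (suc n) ⌋ ∸ 1)
      ≡⟨ cong (λ z → 2 * 2 ^ z) (⌊log₂⌊n/2⌋⌋≡⌊log₂n⌋∸1 (suc (suc n))) ⟨
    2 * 2 ^ ⌊log₂ suc ⌊ n /2⌋ ⌋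
      ≤⟨ *-monoʳ-≤ 2 (ih (s≤s (⌊n/2⌋≤n n))) ⟩
    2 * suc ⌊ n /2⌋
      ≤⟨ 2*⌊n/2⌋≤n (suc (suc n)) ⟩
    suc (suc n) ∎

n<2^n : ∀ n → n < 2 ^ n
n<2^n zero    = s≤s z≤n
n<2^n (suc n) = begin-strict
  suc n           ≤⟨ n<2^n n ⟩
  2 ^ n           <⟨ m<m*n (2 ^ n) 2 {{m^n≢0 2 n}} ≤-refl ⟩
  2 ^ n * 2       ≡⟨ *-comm (2 ^ n) 2 ⟩
  2 ^ suc n       ∎
  where open ≤-Reasoning

-- The threshold k = ⌊log₂ n⌋ / 3 makes (k + 1) 4ᵏ ≤ 8ᵏ ≤ n while ⌊log₂ n⌋ ≤ 3 (k + 1).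
Σ-compactedSize-log : ∀ n → 2 ≤ n →
  Σ (increasingTrees n) compactedSize * ⌊log₂ n ⌋ ≤ 12 * n * length (increasingTrees n)
Σ-compactedSize-log n@(suc _) 2≤n = begin
  X * L                                        ≤⟨ *-monoʳ-≤ X L≤3[1+k] ⟩
  X * (3 * suc k)                              ≡⟨ reorder X (suc k) ⟩
  3 * (suc k * X)                              ≤⟨ *-monoʳ-≤ 3 (Σ-compactedSize k n) ⟩
  3 * ((suc k * 2 ^ (2 * k) + 2 * suc n) * N)
    ≤⟨ *-monoʳ-≤ 3 (*-monoˡ-≤ N (+-mono-≤ [1+k]4^k≤n 2+2n≤3n)) ⟩
  -- The constant is 12 = 3 (1 + 3): the outer 3 from `L ≤ 3 * suc k`, the 1 from the small shapes,
  -- the inner 3 from `2 * suc n ≤ 3 * n`.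
  3 * ((n + 3 * n) * N)                        ≡⟨ twelve n N ⟩
  12 * n * N                                   ∎
  where
  open ≤-Reasoning
  L = ⌊log₂ n ⌋
  k = L / 3
  X = Σ (increasingTrees n) compactedSize
  N = length (increasingTrees n)

  reorder : ∀ x y → x * (3 * y) ≡ 3 * (y * x)
  reorder = solve-∀

  twelve : ∀ n z → 3 * ((n + 3 * n) * z) ≡ 12 * n * z
  twelve = solve-∀

  L≤3[1+k] : L ≤ 3 * suc k
  L≤3[1+k] = begin
    L                  ≡⟨ m≡m%n+[m/n]*n L 3 ⟩
    L % 3 + k * 3      ≤⟨ +-monoˡ-≤ (k * 3) (<⇒≤ (m%n<n L 3)) ⟩
    suc k * 3          ≡⟨ *-comm (suc k) 3 ⟩
    3 * suc k          ∎

  [1+k]4^k≤n : suc k * 2 ^ (2 * k) ≤ n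
  [1+k]4^k≤n = begin
    suc k * 2 ^ (2 * k)     ≤⟨ *-monoˡ-≤ (2 ^ (2 * k)) (n<2^n k) ⟩
    2 ^ k * 2 ^ (2 * k)     ≡⟨ ^-distribˡ-+-* 2 k (2 * k) ⟨
    2 ^ (3 * k)             ≡⟨ cong (2 ^_) (*-comm 3 k) ⟩
    2 ^ (k * 3)             ≤⟨ ^-monoʳ-≤ 2 (m/n*n≤m L 3) ⟩
    2 ^ L                   ≤⟨ 2^⌊log₂n⌋≤n n ⟩
    n                       ∎

  2+2n≤3n : 2 * suc n ≤ 3 * n
  2+2n≤3n = begin
    2 * suc n     ≡⟨ *-suc 2 n ⟩
    2 + 2 * n     ≤⟨ +-monoˡ-≤ (2 * n) 2≤n ⟩
    3 * n         ∎

-- From natural numbers to the rational estimate.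

∣/∣-≤ : ∀ a b c d K .{{_ : NonZero b}} .{{_ : NonZero d}} → a * d ≤ K * c * b →
        ℚ.∣ ℤ.+ a ℚ./ b ∣ ℚ.≤ (ℤ.+ K ℚ./ 1) ℚ.* ℚ.∣ ℤ.+ c ℚ./ d ∣
∣/∣-≤ a (suc b) c (suc d) K ad≤Kcb
  rewrite ℚ.0≤p⇒∣p∣≡p (ℚ.nonNegative⁻¹ (ℤ.+ a ℚ./ suc b) {{ℚ.normalize-nonNeg a (suc b)}})
        | ℚ.0≤p⇒∣p∣≡p (ℚ.nonNegative⁻¹ (ℤ.+ c ℚ./ suc d) {{ℚ.normalize-nonNeg c (suc d)}}) =
  -- Both fractions are nonnegative, so the absolute values are gone. Unnormalised rationals keep
  -- the given denominators, and the order there is cross-multiplication.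
  ℚ.toℚᵘ-cancel-≤ (begin
    ℚ.toℚᵘ (ℤ.+ a ℚ./ suc b)
      ≃⟨ ℚ.toℚᵘ-fromℚᵘ (ℚᵘ.mkℚᵘ (ℤ.+ a) b) ⟩
    ℚᵘ.mkℚᵘ (ℤ.+ a) b
      ≤⟨ ℚᵘ.*≤* cross ⟩
    ℚᵘ.mkℚᵘ (ℤ.+ K) 0 ℚᵘ.* ℚᵘ.mkℚᵘ (ℤ.+ c) d
      ≃⟨ ℚᵘ.*-cong (ℚ.toℚᵘ-fromℚᵘ (ℚᵘ.mkℚᵘ (ℤ.+ K) 0)) (ℚ.toℚᵘ-fromℚᵘ (ℚᵘ.mkℚᵘ (ℤ.+ c) d)) ⟨
    ℚ.toℚᵘ (ℤ.+ K ℚ./ 1) ℚᵘ.* ℚ.toℚᵘ (ℤ.+ c ℚ./ suc d)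
      ≃⟨ ℚ.toℚᵘ-homo-* (ℤ.+ K ℚ./ 1) (ℤ.+ c ℚ./ suc d) ⟨
    ℚ.toℚᵘ ((ℤ.+ K ℚ./ 1) ℚ.* (ℤ.+ c ℚ./ suc d)) ∎)
  where
  open ℚᵘ.≤-Reasoning
  -- The factor `1 * suc d` is the denominator of the product of `K / 1` and `c / suc d`.
  cross : ℤ.+ a ℤ.* ℤ.+ (1 * suc d) ℤ.≤ (ℤ.+ K ℤ.* ℤ.+ c) ℤ.* ℤ.+ suc b
  cross rewrite *-identityˡ (suc d) | sym (ℤ.pos-* a (suc d)) | sym (ℤ.pos-* K c)
              | sym (ℤ.pos-* (K * c) (suc b)) = ℤ.+≤+ ad≤Kcb

theorem3p9 : (λ n → 𝔼 n compactedSize) ∈O n/log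
-- Starting at 2 leaves out the arguments at which `n/log` has the placeholder value 0.
theorem3p9 = ℤ.+ 12 ℚ./ 1 , 2 , λ where
  (suc zero) (s≤s ())
  n@(suc (suc _)) 2≤n →
    ∣/∣-≤ (Σ (increasingTrees n) compactedSize) (length (increasingTrees n)) n ⌊log₂ n ⌋ 12
      {{increasingTrees-nonEmpty n}} (Σ-compactedSize-log n 2≤n)
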